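{- There is $m_0$ such that for every $m\ge m_0$ that is a power of $2$ and every function $f:\{0,1\}^N\to\{0,1\}$, $$C^{dt}_\oplus(f\circ\mathrm{IND}_m^N)\ge C^{dt}(f)\quad\text{and}\quad \mathrm{size}^{dt}_\oplus(f\circ\mathrm{IND}_m^N)\ge 2^{C^{dt}(f)}\ge\mathrm{size}^{dt}(f).$$
   Context: Let $m=2^\ell$. The function $f\circ\mathrm{IND}_m^N$ has Boolean input variables $x_{i,j'}$ ($i\in[N]$, $0\le j'<\ell$) and $y_{i,j}$ ($i\in[N]$, $0\le j<m$), and its value is $f(z)$ where $z_i=y_{i,x_i}$ and $x_i\in\{0,\dots,m-1\}$ is the number with binary representation $x_{i,\ell-1}\cdots x_{i,0}$. A parity decision tree is a rooted binary tree whose internal nodes are labeled by parities ($\mathbb{F}_2$-sums) of input variables, with out-edges labeled $0,1$, and whose leaves are labeled by outputs. $C^{dt}(f)$ and $\mathrm{size}^{dt}(f)$ are the minimum height and minimum number of leaves of an ordinary decision tree (querying single variables) computing $f$; $C^{dt}_\oplus$ and $\mathrm{size}^{dt}_\oplus$ are the corresponding measures for parity decision trees. -}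

module Defs where

open import Data.Bool.Base using (Bool; true; false; _∧_; _xor_; if_then_else_)
import Data.Bool.Properties as Bool
open import Data.Fin.Base using (Fin; zero; suc; _↑ˡ_; _↑ʳ_; combine; funToFin; opposite)
open import Data.Fin.Properties using (2↔Bool)
open import Data.Fin.Subset using (Subset; ⁅_⁆; ⊥)
open import Data.List.Base as List using (List; []; _∷_; _++_; cartesianProductWith; allFin; filter)
import Data.List.Extrema.Nat as Extrema
open import Data.List.Membership.Propositional using (_∈_)
open import Data.List.Membership.Propositional.Properties using (∈-cartesianProductWith⁺; ∈-allFin; ∈-filter⁺; ∈-++⁺ˡ; ∈-++⁺ʳ)
import Data.List.Relation.Unary.All as All
open import Data.List.Relation.Unary.All.Properties using (all-filter)
open import Data.List.Relation.Unary.Any using (here; there)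
open import Data.Nat.Base using (ℕ; zero; suc; _+_; _*_; _^_; _⊔_; _≤_; z≤n; s≤s)
import Data.Nat.Properties as ℕ
open import Data.Product.Base using (∃; _×_; _,_)
open import Data.Sum.Base using (inj₁; inj₂)
open import Data.Vec.Base as Vec using (Vec; []; _∷_; lookup; tabulate; zipWith)
open import Function.Base using (_∘_; id)
open import Function.Bundles using (Inverse)
open import Relation.Binary.PropositionalEquality using (_≡_; refl; trans; cong)
open import Relation.Nullary.Decidable using (Dec; map′)

BoolFun : ℕ → Set
BoolFun n = Vec Bool n → Bool

-- In `node q t₀ t₁`, the out-edge labelled b leads to tᵦ.
data Tree (Q : Set) : Set where
  leaf : Bool → Tree Q
  node : Q → Tree Q → Tree Q → Tree Q

height : ∀ {Q} → Tree Q → ℕ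
height (leaf _)       = 0
height (node _ t₀ t₁) = suc (height t₀ ⊔ height t₁)

leaves : ∀ {Q} → Tree Q → ℕ
leaves (leaf _)       = 1
leaves (node _ t₀ t₁) = leaves t₀ + leaves t₁

eval : ∀ {Q n} → (Q → BoolFun n) → Tree Q → BoolFun n
eval answer (leaf b)       x = b
eval answer (node q t₀ t₁) x = if answer q x then eval answer t₁ x else eval answer t₀ x

Computes : ∀ {Q n} → (Q → BoolFun n) → BoolFun n → Tree Q → Set
Computes answer f t = ∀ x → eval answer t x ≡ f x

variableQuery : ∀ {n} → Fin n → BoolFun n
variableQuery i x = lookup x i

-- The 𝔽₂-sum of the variables x_i with i ∈ S.
parityQuery : ∀ {n} → Subset n → BoolFun n
parityQuery S x = Vec.foldr _ _xor_ false (zipWith _∧_ S x)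

record Minimum {A : Set} (P : A → Set) (μ : A → ℕ) : Set where
  field
    value    : ℕ
    attained : ∃ λ a → P a × μ a ≡ value
    least    : ∀ a → P a → value ≤ μ a

open Minimum public using (value; attained; least)

-- Existence of the four minima. There are finitely many trees of bounded
-- height, and `leaves` bounds `height`, so both measures can be minimised
-- by exhaustive search.
module _ where
  private
    allVecs : ∀ n → List (Vec Bool n)
    allVecs zero    = [] ∷ []
    allVecs (suc n) = cartesianProductWith _∷_ (false ∷ true ∷ []) (allVecs n)

    ∈-bools : ∀ b → b ∈ false ∷ true ∷ []
    ∈-bools false = here refl
    ∈-bools true  = there (here refl)

    ∈-allVecs : ∀ {n} (x : Vec Bool n) → x ∈ allVecs n
    ∈-allVecs []      = here refl
    ∈-allVecs (b ∷ x) = ∈-cartesianProductWith⁺ _∷_ (∈-bools b) (∈-allVecs x)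

    computes? : ∀ {Q n} (answer : Q → BoolFun n) f (t : Tree Q) → Dec (Computes answer f t)
    computes? {n = n} answer f t =
      map′ (λ ps x → All.lookup ps (∈-allVecs x)) (λ h → All.universal h (allVecs n))
           (All.all? (λ x → eval answer t x Bool.≟ f x) (allVecs n))

    trees : ∀ {Q} → List Q → ℕ → List (Tree Q)
    trees qs zero    = List.map leaf (false ∷ true ∷ [])
    trees qs (suc d) = List.map leaf (false ∷ true ∷ []) ++
      cartesianProductWith id (cartesianProductWith node qs (trees qs d)) (trees qs d)

    ∈-leaves : ∀ {Q} b → leaf {Q} b ∈ List.map leaf (false ∷ true ∷ [])
    ∈-leaves false = here refl
    ∈-leaves true  = there (here refl)

    ∈-trees : ∀ {Q} {qs : List Q} → (∀ q → q ∈ qs) → ∀ {d} t → height t ≤ d → t ∈ trees qs d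
    ∈-trees ∈qs {zero}  (leaf b) _ = ∈-leaves b
    ∈-trees ∈qs {suc d} (leaf b) _ = ∈-++⁺ˡ (∈-leaves b)
    ∈-trees ∈qs {suc d} (node q t₀ t₁) (s≤s h) = ∈-++⁺ʳ (List.map leaf (false ∷ true ∷ []))
      (∈-cartesianProductWith⁺ id
        (∈-cartesianProductWith⁺ node (∈qs q) (∈-trees ∈qs t₀ (ℕ.m⊔n≤o⇒m≤o _ _ h)))
        (∈-trees ∈qs t₁ (ℕ.m⊔n≤o⇒n≤o (height t₀) _ h)))

    minimum : ∀ {Q n} {qs : List Q} → (∀ q → q ∈ qs) → (answer : Q → BoolFun n) (f : BoolFun n) →
              ∃ (Computes answer f) → (μ : Tree Q → ℕ) → (∀ t → height t ≤ μ t) →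
              Minimum (Computes answer f) μ
    minimum {Q} {qs = qs} ∈qs answer f (t , t-ok) μ height≤μ = record
      { value    = μ best
      ; attained = best , Extrema.argmin-all μ {⊤ = t} {xs = candidates} {P = Computes answer f} t-ok
                            (all-filter (computes? answer f) (trees qs (μ t))) , refl
      ; least    = best-least
      }
      where
      candidates : List (Tree Q)
      candidates = filter (computes? answer f) (trees qs (μ t))

      best : Tree Q
      best = Extrema.argmin μ t candidates

      best-least : ∀ s → Computes answer f s → μ best ≤ μ s
      best-least s s-ok with ℕ.≤-total (μ s) (μ t)
      ... | inj₂ t≤s = ℕ.≤-trans (Extrema.f[argmin]≤f[⊤] {f = μ} t candidates) t≤s
      ... | inj₁ s≤t = All.lookup (Extrema.f[argmin]≤f[xs] {f = μ} t candidates)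
        (∈-filter⁺ (computes? answer f) (∈-trees ∈qs s (ℕ.≤-trans (height≤μ s) s≤t)) s-ok)

    1≤leaves : ∀ {Q} (t : Tree Q) → 1 ≤ leaves t
    1≤leaves (leaf _)       = s≤s z≤n
    1≤leaves (node _ t₀ t₁) = ℕ.≤-trans (1≤leaves t₀) (ℕ.m≤m+n _ _)

    height≤leaves : ∀ {Q} (t : Tree Q) → height t ≤ leaves t
    height≤leaves t = ℕ.<⇒≤ (go t)
      where
      go : ∀ {Q} (t : Tree Q) → suc (height t) ≤ leaves t
      go (leaf _)       = s≤s z≤n
      go (node _ t₀ t₁) = ℕ.⊔-lub {y = suc (suc (height t₀))} {z = suc (suc (height t₁))}
        (ℕ.≤-trans (ℕ.≤-reflexive (ℕ.+-comm 1 (suc (height t₀)))) (ℕ.+-mono-≤ (go t₀) (1≤leaves t₁)))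
        (ℕ.+-mono-≤ (1≤leaves t₀) (go t₁))

    mapTree : ∀ {P Q} → (P → Q) → Tree P → Tree Q
    mapTree g (leaf b)       = leaf b
    mapTree g (node q t₀ t₁) = node (g q) (mapTree g t₀) (mapTree g t₁)

    eval-mapTree : ∀ {P Q m n} (g : P → Q) (a : P → BoolFun m) (a′ : Q → BoolFun n) x x′ →
                   (∀ p → a′ (g p) x′ ≡ a p x) → ∀ t → eval a′ (mapTree g t) x′ ≡ eval a t x
    eval-mapTree g a a′ x x′ h (leaf b) = refl
    eval-mapTree g a a′ x x′ h (node q t₀ t₁) rewrite h q
      | eval-mapTree g a a′ x x′ h t₀ | eval-mapTree g a a′ x x′ h t₁ = refl

    full : ∀ {n} (f : BoolFun n) → ∃ (Computes variableQuery f)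
    full {zero}  f = leaf (f []) , λ { [] → refl }
    full {suc n} f with full (f ∘ (false ∷_)) | full (f ∘ (true ∷_))
    ... | t₀ , ok₀ | t₁ , ok₁ = node zero (mapTree suc t₀) (mapTree suc t₁) , λ
      { (false ∷ x) → trans (eval-mapTree suc variableQuery variableQuery x _ (λ _ → refl) t₀) (ok₀ x)
      ; (true  ∷ x) → trans (eval-mapTree suc variableQuery variableQuery x _ (λ _ → refl) t₁) (ok₁ x) }

    parity-⊥ : ∀ {n} (x : Vec Bool n) → parityQuery ⊥ x ≡ false
    parity-⊥ []      = refl
    parity-⊥ (_ ∷ x) = parity-⊥ x

    parity-⁅⁆ : ∀ {n} (i : Fin n) x → parityQuery ⁅ i ⁆ x ≡ lookup x i
    parity-⁅⁆ zero    (b ∷ x) = trans (cong (b xor_) (parity-⊥ x)) (Bool.xor-identityʳ b)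
    parity-⁅⁆ (suc i) (_ ∷ x) = parity-⁅⁆ i x

    full⊕ : ∀ {n} (f : BoolFun n) → ∃ (Computes parityQuery f)
    full⊕ f with full f
    ... | t , ok = mapTree ⁅_⁆ t , λ x →
      trans (eval-mapTree ⁅_⁆ variableQuery parityQuery x x (λ i → parity-⁅⁆ i x) t) (ok x)

  abstract
    minHeight : ∀ {n} (f : BoolFun n) → Minimum (Computes variableQuery f) height
    minHeight f = minimum ∈-allFin variableQuery f (full f) height (λ _ → ℕ.≤-refl)

    minLeaves : ∀ {n} (f : BoolFun n) → Minimum (Computes variableQuery f) leaves
    minLeaves f = minimum ∈-allFin variableQuery f (full f) leaves height≤leaves

    minHeight⊕ : ∀ {n} (f : BoolFun n) → Minimum (Computes parityQuery f) height
    minHeight⊕ f = minimum ∈-allVecs parityQuery f (full⊕ f) height (λ _ → ℕ.≤-refl)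

    minLeaves⊕ : ∀ {n} (f : BoolFun n) → Minimum (Computes parityQuery f) leaves
    minLeaves⊕ f = minimum ∈-allVecs parityQuery f (full⊕ f) leaves height≤leaves

Cᵈᵗ sizeᵈᵗ Cᵈᵗ⊕ sizeᵈᵗ⊕ : ∀ {n} → BoolFun n → ℕ
Cᵈᵗ     f = value (minHeight f)
sizeᵈᵗ  f = value (minLeaves f)
Cᵈᵗ⊕    f = value (minHeight⊕ f)
sizeᵈᵗ⊕ f = value (minLeaves⊕ f)

xVar : ∀ {N ℓ} → Fin N → Fin ℓ → Fin (N * ℓ + N * 2 ^ ℓ)
xVar {N} {ℓ} i j′ = combine i j′ ↑ˡ (N * 2 ^ ℓ)

yVar : ∀ {N ℓ} → Fin N → Fin (2 ^ ℓ) → Fin (N * ℓ + N * 2 ^ ℓ)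
yVar {N} {ℓ} i j = (N * ℓ) ↑ʳ combine i j

-- The number with binary representation b_{ℓ-1} ⋯ b_0; `funToFin` reads its
-- digits most significant first, hence `opposite`.
fromBits : ∀ {ℓ} → (Fin ℓ → Bool) → Fin (2 ^ ℓ)
fromBits b = funToFin (Inverse.from 2↔Bool ∘ b ∘ opposite)

infixr 9 _∘IND^_

-- `f ∘IND^ ℓ` is f ∘ IND_m^N with m = 2 ^ ℓ.
_∘IND^_ : ∀ {N} → BoolFun N → (ℓ : ℕ) → BoolFun (N * ℓ + N * 2 ^ ℓ)
(f ∘IND^ ℓ) v = f (tabulate λ i → lookup v (yVar i (fromBits λ j′ → lookup v (xVar {ℓ = ℓ} i j′))))

{-# OPTIONS --safe #-}
-- Already for m = 2 the gadget is 1-stifled: whichever single variable v of a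
-- block is left free, the others can be fixed so that the gadget outputs a
-- prescribed bit b no matter what v is. A parity decision tree T for f ∘ IND is
-- therefore simulated by an ordinary tree for f as follows. A parity that is
-- constant under the restrictions made so far costs nothing. Otherwise it
-- depends on some variable v, say of block i: query z_i, fix block i except v
-- so that it outputs the answer, and spend v on sending the parity to the child
-- with fewer leaves. Each query thus halves the number of leaves of T, so that
-- 2 ^ height ≤ leaves T. The restrictions are substitutions by affine maps,
-- which keep parities affine.
module Submission where

open import Defs
open import Data.Bool.Base using (Bool; true; false; not; _xor_; _∧_; if_then_else_)
import Data.Bool.Properties as Bool
open import Data.Bool.Solver using (module xor-∧-Solver)
open import Data.Fin.Base using (Fin; zero; suc; splitAt; quotient; funToFin; finToFun; combine; opposite)
import Data.Fin.Properties as Fin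
open import Data.Nat.Base using (ℕ; zero; suc; _+_; _*_; _^_; _⊔_; _≤_; _≥_; z≤n; s≤s)
import Data.Nat.Properties as ℕ
open import Data.Product.Base using (∃; ∃-syntax; _×_; _,_; proj₁; proj₂)
open import Data.Sum.Base using (_⊎_; inj₁; inj₂; [_,_]′)
open import Data.Vec.Base using (Vec; []; _∷_; lookup; tabulate; zipWith; replicate; updateAt; _[_]≔_)
open import Data.Vec.Properties using (lookup∘tabulate; tabulate∘lookup; tabulate-cong; lookup-zipWith; lookup∘updateAt; lookup∘updateAt′; lookup∘update; lookup∘update′; []≔-lookup)
open import Function.Base using (_∘_; id; const; case_of_)
open import Function.Bundles using (Inverse)
open import Relation.Binary.PropositionalEquality using (_≡_; _≢_; _≗_; refl; sym; trans; cong; cong₂; subst; module ≡-Reasoning)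
open import Relation.Nullary.Decidable using (yes; no; does; dec-true; dec-false)

lookup-ext : ∀ {A : Set} {n} {x y : Vec A n} → (∀ i → lookup x i ≡ lookup y i) → x ≡ y
lookup-ext {x = x} {y} x≗y =
  trans (sym (tabulate∘lookup x)) (trans (tabulate-cong x≗y) (tabulate∘lookup y))

-- Affine functions and maps over 𝔽₂

infixr 6 _⊕_

_⊕_ : ∀ {n} → Vec Bool n → Vec Bool n → Vec Bool n
_⊕_ = zipWith _xor_

-- Over the two-element field, preserving sums of three points characterises affine functions. This
-- form names no coefficients and passes through substitutions unchanged.
Affine : ∀ {n} → BoolFun n → Set
Affine h = ∀ x y z → h (x ⊕ y ⊕ z) ≡ h x xor (h y xor h z)

AffineMap : ∀ {m n} → (Vec Bool m → Vec Bool n) → Set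
AffineMap σ = ∀ x y z → σ (x ⊕ y ⊕ z) ≡ σ x ⊕ σ y ⊕ σ z

lookup-⊕³ : ∀ {n} (x y z : Vec Bool n) i →
            lookup (x ⊕ y ⊕ z) i ≡ lookup x i xor (lookup y i xor lookup z i)
lookup-⊕³ x y z i =
  trans (lookup-zipWith _xor_ i x (y ⊕ z)) (cong (lookup x i xor_) (lookup-zipWith _xor_ i y z))

affineMap⁺ : ∀ {m n} {σ : Vec Bool m → Vec Bool n} → (∀ i → Affine (λ x → lookup (σ x) i)) → AffineMap σ
affineMap⁺ {σ = σ} coord x y z =
  lookup-ext λ i → trans (coord i x y z) (sym (lookup-⊕³ (σ x) (σ y) (σ z) i))

affineMap⁻ : ∀ {m n} {σ : Vec Bool m → Vec Bool n} → AffineMap σ → ∀ i → Affine (λ x → lookup (σ x) i)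
affineMap⁻ {σ = σ} σ-aff i x y z =
  trans (cong (λ u → lookup u i) (σ-aff x y z)) (lookup-⊕³ (σ x) (σ y) (σ z) i)

affine-const : ∀ {n} b → Affine {n} (const b)
affine-const b _ _ _ = sym (trans (cong (b xor_) (Bool.xor-same b)) (Bool.xor-identityʳ b))

affine-xor : ∀ {n} {g h : BoolFun n} → Affine g → Affine h → Affine (λ x → g x xor h x)
affine-xor {g = g} {h} g-aff h-aff x y z = trans (cong₂ _xor_ (g-aff x y z) (h-aff x y z))
  (solve 6 (λ a b c p q r → (a :+ (b :+ c)) :+ (p :+ (q :+ r)) := (a :+ p) :+ ((b :+ q) :+ (c :+ r)))
     refl (g x) (g y) (g z) (h x) (h y) (h z))
  where open xor-∧-Solver

affine-∘ : ∀ {m n} {h : BoolFun n} {σ : Vec Bool m → Vec Bool n} → Affine h → AffineMap σ → Affine (h ∘ σ)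
affine-∘ {h = h} {σ} h-aff σ-aff x y z = trans (cong h (σ-aff x y z)) (h-aff (σ x) (σ y) (σ z))

affineMap-∘ : ∀ {k m n} {σ : Vec Bool m → Vec Bool n} {τ : Vec Bool k → Vec Bool m} →
              AffineMap σ → AffineMap τ → AffineMap (σ ∘ τ)
affineMap-∘ {σ = σ} {τ} σ-aff τ-aff x y z = trans (cong σ (τ-aff x y z)) (σ-aff (τ x) (τ y) (τ z))

affine-parityQuery : ∀ {n} (S : Vec Bool n) → Affine (parityQuery S)
affine-parityQuery []      []      []      []      = refl
affine-parityQuery (s ∷ S) (a ∷ x) (b ∷ y) (c ∷ z) =
  trans (cong ((s ∧ (a xor (b xor c))) xor_) (affine-parityQuery S x y z))
    (solve 7 (λ s a b c p q r → (s :* (a :+ (b :+ c))) :+ (p :+ (q :+ r)) :=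
                                (s :* a :+ p) :+ ((s :* b :+ q) :+ (s :* c :+ r)))
       refl s a b c (parityQuery S x) (parityQuery S y) (parityQuery S z))
  where open xor-∧-Solver

-- Dependence of affine functions on a single variable

add : ∀ {n} → Fin n → Bool → Vec Bool n → Vec Bool n
add v d x = updateAt x v (d xor_)

-- For affine `h` this says that the variable `v` has coefficient 1.
DependsOn : ∀ {n} → BoolFun n → Fin n → Set
DependsOn h v = ∀ d x → h (add v d x) ≡ d xor h x

zeros : ∀ {n} → Vec Bool n
zeros = replicate _ false

zeros-⊕ : ∀ {n} (x : Vec Bool n) → zeros ⊕ x ≡ x
zeros-⊕ []      = refl
zeros-⊕ (_ ∷ x) = cong (_ ∷_) (zeros-⊕ x)

-- Write `b ∷ x` as `b ∷ zeros` plus `false ∷ zeros` plus `false ∷ x`; the zero vector only brings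
-- the number of summands to three.
affine-∷ : ∀ {n} {h : BoolFun (suc n)} → Affine h → ∀ b x →
           h (b ∷ x) ≡ h (b ∷ zeros) xor (h (false ∷ zeros) xor h (false ∷ x))
affine-∷ {h = h} h-aff b x = trans
  (cong h (cong₂ _∷_ (sym (Bool.xor-identityʳ b)) (sym (trans (zeros-⊕ (zeros ⊕ x)) (zeros-⊕ x)))))
  (h-aff (b ∷ zeros) (false ∷ zeros) (false ∷ x))

-- Induction on `n`, restricting to inputs with head `false`. A dependence found there persists for
-- both heads. If the restriction is constantly `c`, then `h` is a function of the head alone, and
-- comparing `h (true ∷ zeros)` with `c` decides.
constant⊎dependsOn : ∀ {n} {h : BoolFun n} → Affine h → (∃ λ c → ∀ x → h x ≡ c) ⊎ ∃ (DependsOn h)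
constant⊎dependsOn {zero}  {h} _     = inj₁ (h [] , λ { [] → refl })
constant⊎dependsOn {suc n} {h} h-aff
  with constant⊎dependsOn {n} {h ∘ (false ∷_)} (λ x y z → h-aff (false ∷ x) (false ∷ y) (false ∷ z))
... | inj₂ (v , dep) = inj₂ (suc v , dep′)
  where
  open xor-∧-Solver
  dep′ : DependsOn h (suc v)
  dep′ d (b ∷ x) = begin
    h (b ∷ add v d x)
      ≡⟨ affine-∷ {h = h} h-aff b (add v d x) ⟩
    h (b ∷ zeros) xor (h (false ∷ zeros) xor h (false ∷ add v d x))
      ≡⟨ cong (λ u → h (b ∷ zeros) xor (h (false ∷ zeros) xor u)) (dep d x) ⟩
    h (b ∷ zeros) xor (h (false ∷ zeros) xor (d xor h (false ∷ x)))
      ≡⟨ solve 4 (λ p q d u → p :+ (q :+ (d :+ u)) := d :+ (p :+ (q :+ u))) refl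
           (h (b ∷ zeros)) (h (false ∷ zeros)) d (h (false ∷ x)) ⟩
    d xor (h (b ∷ zeros) xor (h (false ∷ zeros) xor h (false ∷ x)))
      ≡⟨ cong (d xor_) (affine-∷ {h = h} h-aff b x) ⟨
    d xor h (b ∷ x) ∎
    where open ≡-Reasoning
... | inj₁ (c , h₀≡c) = byHead
  where
  head-only : ∀ b x → h (b ∷ x) ≡ h (b ∷ zeros)
  head-only b x = begin
    h (b ∷ x)
      ≡⟨ affine-∷ {h = h} h-aff b x ⟩
    h (b ∷ zeros) xor (h (false ∷ zeros) xor h (false ∷ x))
      ≡⟨ cong (h (b ∷ zeros) xor_) (trans (cong₂ _xor_ (h₀≡c zeros) (h₀≡c x)) (Bool.xor-same c)) ⟩
    h (b ∷ zeros) xor false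
      ≡⟨ Bool.xor-identityʳ _ ⟩
    h (b ∷ zeros) ∎
    where open ≡-Reasoning

  byHead : (∃ λ c → ∀ x → h x ≡ c) ⊎ ∃ (DependsOn h)
  byHead with h (true ∷ zeros) Bool.≟ c
  ... | yes h₁≡c = inj₁ (c , λ { (false ∷ x) → h₀≡c x ; (true ∷ x) → trans (head-only true x) h₁≡c })
  ... | no  h₁≢c = inj₂ (zero , λ
    { false (_ ∷ _)     → refl
    ; true  (false ∷ x) → trans (h₁≡not-c x) (cong not (sym (h₀≡c x)))
    ; true  (true ∷ x)  → trans (h₀≡c x)
        (trans (sym (Bool.not-involutive c)) (cong not (sym (h₁≡not-c x)))) })
    where
    h₁≡not-c : ∀ x → h (true ∷ x) ≡ not c
    h₁≡not-c x = trans (head-only true x) (Bool.¬-not h₁≢c)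

module Steer {n} {h : BoolFun n} {v : Fin n} {β : Vec Bool n → Vec Bool n}
             (h-aff : Affine h) (dep : DependsOn h v) (β-aff : AffineMap β) (c : Bool) where

  correction : BoolFun n
  correction x = h (β x) xor c

  -- The coordinate `v` absorbs the discrepancy between `h (β x)` and the target `c`. The correction
  -- varies with `x`, but affinely, so the substitution remains affine.
  steer : Vec Bool n → Vec Bool n
  steer x = add v (correction x) (β x)

  h-steer : ∀ x → h (steer x) ≡ c
  h-steer x = begin
    h (steer x)                     ≡⟨ dep (correction x) (β x) ⟩
    (h (β x) xor c) xor h (β x)     ≡⟨ cong (_xor h (β x)) (Bool.xor-comm (h (β x)) c) ⟩
    (c xor h (β x)) xor h (β x)     ≡⟨ Bool.xor-assoc c _ _ ⟩
    c xor (h (β x) xor h (β x))     ≡⟨ cong (c xor_) (Bool.xor-same (h (β x))) ⟩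
    c xor false                     ≡⟨ Bool.xor-identityʳ c ⟩
    c                               ∎
    where open ≡-Reasoning

  steer-affine : AffineMap steer
  steer-affine = affineMap⁺ coord
    where
    coord : ∀ i → Affine (λ x → lookup (steer x) i)
    coord i x y z with i Fin.≟ v
    ... | yes refl
      rewrite lookup∘updateAt v {correction (x ⊕ y ⊕ z) xor_} (β (x ⊕ y ⊕ z))
            | lookup∘updateAt v {correction x xor_} (β x)
            | lookup∘updateAt v {correction y xor_} (β y)
            | lookup∘updateAt v {correction z xor_} (β z)
      = affine-xor {g = correction} {λ x → lookup (β x) v}
          (affine-xor {g = h ∘ β} {const c} (affine-∘ {h = h} h-aff β-aff) (affine-const c))
          (affineMap⁻ β-aff v) x y z
    ... | no i≢v
      rewrite lookup∘updateAt′ i v {correction (x ⊕ y ⊕ z) xor_} i≢v (β (x ⊕ y ⊕ z))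
            | lookup∘updateAt′ i v {correction x xor_} i≢v (β x)
            | lookup∘updateAt′ i v {correction y xor_} i≢v (β y)
            | lookup∘updateAt′ i v {correction z xor_} i≢v (β z)
      = affineMap⁻ β-aff i x y z

-- Lifting for stifled gadgets

-- G is the vector of all gadgets; β fixes the block i of v except for v itself.
Stifled : ∀ {n N} → (Vec Bool n → Vec Bool N) → Set
Stifled G = ∀ v → ∃ λ i → ∀ b → ∃ λ β →
  AffineMap β × (∀ d x → G (add v d (β x)) ≡ G x [ i ]≔ b)

child : ∀ {Q : Set} → Tree Q → Tree Q → Bool → Tree Q
child t₀ t₁ c = if c then t₁ else t₀

eval-child : ∀ {Q n} (answer : Q → BoolFun n) q t₀ t₁ x {c} → answer q x ≡ c →
             eval answer (node q t₀ t₁) x ≡ eval answer (child t₀ t₁ c) x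
eval-child answer q t₀ t₁ x {false} eq rewrite eq = refl
eval-child answer q t₀ t₁ x {true}  eq rewrite eq = refl

leaves-child≤ : ∀ {Q : Set} (t₀ t₁ : Tree Q) c → leaves (child t₀ t₁ c) ≤ leaves t₀ + leaves t₁
leaves-child≤ t₀ t₁ false = ℕ.m≤m+n _ _
leaves-child≤ t₀ t₁ true  = ℕ.m≤n+m _ _

lighterChild : ∀ {Q : Set} (t₀ t₁ : Tree Q) → ∃ λ c → 2 * leaves (child t₀ t₁ c) ≤ leaves t₀ + leaves t₁
lighterChild t₀ t₁ with ℕ.≤-total (leaves t₀) (leaves t₁)
... | inj₁ t₀≤t₁ = false , ℕ.+-monoʳ-≤ (leaves t₀) (ℕ.≤-trans (ℕ.≤-reflexive (ℕ.+-identityʳ _)) t₀≤t₁)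
... | inj₂ t₁≤t₀ = true  , ℕ.+-mono-≤ t₁≤t₀ (ℕ.≤-reflexive (ℕ.+-identityʳ _))

leaves≤2^height : ∀ {Q} (t : Tree Q) → leaves t ≤ 2 ^ height t
leaves≤2^height (leaf _)       = ℕ.≤-refl
leaves≤2^height (node _ t₀ t₁) = ℕ.+-mono-≤
  (ℕ.≤-trans (leaves≤2^height t₀) (ℕ.^-monoʳ-≤ 2 (ℕ.m≤m⊔n (height t₀) (height t₁))))
  (ℕ.≤-trans (leaves≤2^height t₁)
    (ℕ.≤-trans (ℕ.^-monoʳ-≤ 2 (ℕ.m≤n⊔m (height t₀) (height t₁))) (ℕ.≤-reflexive (sym (ℕ.+-identityʳ _)))))

2^⊔≤ : ∀ {a b k} → 2 ^ a ≤ k → 2 ^ b ≤ k → 2 ^ (a ⊔ b) ≤ k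
2^⊔≤ {a} {b} 2^a≤k 2^b≤k with ℕ.⊔-sel a b
... | inj₁ eq rewrite eq = 2^a≤k
... | inj₂ eq rewrite eq = 2^b≤k

module _ {n N} {G : Vec Bool n → Vec Bool N}
         (G-surjective : ∀ z → ∃ λ x → G x ≡ z) (G-stifled : Stifled G) where

  -- Both `σ` and `f` are quantified to make the induction go through: `σ` accumulates the
  -- substitutions made so far, and `f` is replaced by its restrictions.
  Simulated : Tree (Vec Bool n) → Set
  Simulated T = ∀ {σ : Vec Bool n → Vec Bool n} → AffineMap σ → (f : BoolFun N) →
    (∀ x → eval parityQuery T (σ x) ≡ f (G x)) →
    ∃ λ t → Computes variableQuery f t × 2 ^ height t ≤ leaves T

  simulate-node : ∀ S {t₀ t₁} → (∀ c → Simulated (child t₀ t₁ c)) → Simulated (node S t₀ t₁)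
  simulate-node S {t₀} {t₁} ih {σ} σ-aff f T-computes
    with constant⊎dependsOn (affine-∘ {h = parityQuery S} (affine-parityQuery S) σ-aff)
  ... | inj₁ (c , S≡c) =
    let t , t-computes , t-small = ih c σ-aff f λ x →
          trans (sym (eval-child parityQuery S t₀ t₁ (σ x) (S≡c x))) (T-computes x)
    in  t , t-computes , ℕ.≤-trans t-small (leaves-child≤ t₀ t₁ c)
  ... | inj₂ (v , dep) =
    node i (proj₁ (subtree false)) (proj₁ (subtree true)) , computes ,
    ℕ.≤-trans
      (ℕ.*-monoʳ-≤ 2 (2^⊔≤ {height (proj₁ (subtree false))}
        (proj₂ (proj₂ (subtree false))) (proj₂ (proj₂ (subtree true)))))
      (proj₂ (lighterChild t₀ t₁))
    where
    i = proj₁ (G-stifled v)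
    c = proj₁ (lighterChild t₀ t₁)

    subtree : ∀ b → ∃ λ t → Computes variableQuery (λ z → f (z [ i ]≔ b)) t ×
                            2 ^ height t ≤ leaves (child t₀ t₁ c)
    subtree b with proj₂ (G-stifled v) b
    -- Both answers `b` continue in the same child of `T`, the lighter one; hence the halving. The
    -- restriction of `f` overwrites coordinate `i`, so it keeps all `N` variables.
    ... | β , β-aff , G-β = ih c (affineMap-∘ σ-aff steer-affine) _ λ x → begin
      eval parityQuery (child t₀ t₁ c) (σ (steer x))
        ≡⟨ eval-child parityQuery S t₀ t₁ (σ (steer x)) (h-steer x) ⟨
      eval parityQuery (node S t₀ t₁) (σ (steer x))
        ≡⟨ T-computes (steer x) ⟩
      f (G (steer x))
        -- Stifling holds for every `d`, so `d` may be a value that depends on `x`.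
        ≡⟨ cong f (G-β (correction x) x) ⟩
      f (G x [ i ]≔ b) ∎
      where
      open ≡-Reasoning
      open Steer {h = parityQuery S ∘ σ} (affine-∘ {h = parityQuery S} (affine-parityQuery S) σ-aff) dep β-aff c

    computes : Computes variableQuery f (node i (proj₁ (subtree false)) (proj₁ (subtree true)))
    computes z with lookup z i in eq
    ... | false = trans (proj₁ (proj₂ (subtree false)) z)
                        (cong f (trans (cong (z [ i ]≔_) (sym eq)) ([]≔-lookup z i)))
    ... | true  = trans (proj₁ (proj₂ (subtree true)) z)
                        (cong f (trans (cong (z [ i ]≔_) (sym eq)) ([]≔-lookup z i)))

  simulate : ∀ T → Simulated T
  simulate (leaf b) _ f T-computes = leaf b , computes , ℕ.≤-refl
    where
    computes : Computes variableQuery f (leaf b)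
    -- The leaf fixes `f` only on the image of `G`; surjectivity makes that everything.
    computes z = let x , Gx≡z = G-surjective z in trans (T-computes x) (cong f Gx≡z)
  -- The bit is chosen inside `simulate-node`; splitting on it here makes the recursion structural.
  simulate (node S t₀ t₁) = simulate-node S {t₀} {t₁} λ { false → simulate t₀ ; true → simulate t₁ }

  2^Cᵈᵗ≤leaves⊕ : ∀ f T → Computes parityQuery (f ∘ G) T → 2 ^ Cᵈᵗ f ≤ leaves T
  2^Cᵈᵗ≤leaves⊕ f T T-computes =
    let t , t-computes , t-small = simulate T {σ = id} (λ _ _ _ → refl) f T-computes
    in  ℕ.≤-trans (ℕ.^-monoʳ-≤ 2 (least (minHeight f) t t-computes)) t-small

-- The indexing gadget

funToFin-cong : ∀ {m n} {f g : Fin m → Fin n} → f ≗ g → funToFin f ≡ funToFin g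
funToFin-cong {zero}  f≗g = refl
funToFin-cong {suc m} f≗g = cong₂ combine (f≗g zero) (funToFin-cong (f≗g ∘ suc))

constBits : ∀ ℓ → Bool → Fin (2 ^ ℓ)
constBits ℓ b = fromBits {ℓ} (const b)

fromBits-cong : ∀ {ℓ} {a b : Fin ℓ → Bool} → a ≗ b → fromBits {ℓ} a ≡ fromBits b
fromBits-cong a≗b = funToFin-cong λ j → cong (Inverse.from Fin.2↔Bool) (a≗b (opposite j))

-- The leading digit recovers the bit. At least one digit must exist, whence `suc ℓ`.
constBits-injective : ∀ {ℓ b c} → constBits (suc ℓ) b ≡ constBits (suc ℓ) c → b ≡ c
constBits-injective {ℓ} {b} {c} eq = trans (sym (digit-constBits b)) (trans (cong digit eq) (digit-constBits c))
  where
  digit : Fin (2 ^ suc ℓ) → Bool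
  digit k = Inverse.to Fin.2↔Bool (finToFun {2} {suc ℓ} k zero)

  digit-constBits : ∀ b → digit (constBits (suc ℓ) b) ≡ b
  digit-constBits b = trans
    (cong (Inverse.to Fin.2↔Bool) (Fin.finToFun-funToFin {suc ℓ} (λ _ → Inverse.from Fin.2↔Bool b) zero))
    (Inverse.strictlyInverseˡ Fin.2↔Bool b)

module Indexing (N ℓ : ℕ) where

  Var : Set
  Var = Fin (N * ℓ + N * 2 ^ ℓ)

  X : Fin N → Fin ℓ → Var
  X = xVar

  Y : Fin N → Fin (2 ^ ℓ) → Var
  Y = yVar {ℓ = ℓ}

  pointer : Vec Bool (N * ℓ + N * 2 ^ ℓ) → Fin N → Fin (2 ^ ℓ)
  pointer x i = fromBits λ j → lookup x (X i j)

  IND : Vec Bool (N * ℓ + N * 2 ^ ℓ) → Vec Bool N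
  IND x = tabulate λ i → lookup x (Y i (pointer x i))

  block : Var → Fin N
  block w = [ quotient ℓ , quotient (2 ^ ℓ) ]′ (splitAt (N * ℓ) w)

  block-X : ∀ i j → block (X i j) ≡ i
  block-X i j rewrite Fin.splitAt-↑ˡ (N * ℓ) (combine i j) (N * 2 ^ ℓ) = cong proj₁ (Fin.remQuot-combine i j)

  block-Y : ∀ i k → block (Y i k) ≡ i
  block-Y i k rewrite Fin.splitAt-↑ʳ (N * ℓ) (N * 2 ^ ℓ) (combine i k) = cong proj₁ (Fin.remQuot-combine i k)

  -- Pointer bits get `e` and data bits get `b`. A block filled this way points at `constBits ℓ e`
  -- and outputs `b`; with distinct values the function also tells the two kinds apart.
  byKind : Bool → Bool → Var → Bool
  byKind e b w = [ const e , const b ]′ (splitAt (N * ℓ) w)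

  byKind-X : ∀ e b i j → byKind e b (X i j) ≡ e
  byKind-X e b i j rewrite Fin.splitAt-↑ˡ (N * ℓ) (combine i j) (N * 2 ^ ℓ) = refl

  byKind-Y : ∀ e b i k → byKind e b (Y i k) ≡ b
  byKind-Y e b i k rewrite Fin.splitAt-↑ʳ (N * ℓ) (N * 2 ^ ℓ) (combine i k) = refl

  X≢Y : ∀ {i j i′ k} → X i j ≢ Y i′ k
  X≢Y {i} {j} {i′} {k} eq =
    case trans (sym (byKind-X false true i j)) (trans (cong (byKind false true) eq) (byKind-Y false true i′ k)) of λ ()

  Y-injective : ∀ i {k k′} → Y i k ≡ Y i k′ → k ≡ k′
  Y-injective i {k} {k′} eq = Fin.combine-injectiveʳ i k i k′ (Fin.↑ʳ-injective (N * ℓ) _ _ eq)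

  IND-surjective : ∀ z → ∃ λ x → IND x ≡ z
  IND-surjective z = x , trans (tabulate-cong x-y) (tabulate∘lookup z)
    where
    -- Every variable of block `i` is set to the value of `z` at `i`, so the pointer does not
    -- matter.
    x = tabulate (lookup z ∘ block)

    x-y : ∀ i → lookup x (Y i (pointer x i)) ≡ lookup z i
    x-y i = trans (lookup∘tabulate (lookup z ∘ block) (Y i (pointer x i))) (cong (lookup z) (block-Y i (pointer x i)))

  -- The whole block becomes constant, including the variable meant to stay free; a subsequent
  -- `add v d` gives that variable its freedom back.
  freeze : Fin N → Bool → Bool → Vec Bool (N * ℓ + N * 2 ^ ℓ) → Vec Bool (N * ℓ + N * 2 ^ ℓ)
  freeze i e b x = tabulate λ w → if does (block w Fin.≟ i) then byKind e b w else lookup x w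

  lookup-freeze-≡ : ∀ {i} e b x {w} → block w ≡ i → lookup (freeze i e b x) w ≡ byKind e b w
  lookup-freeze-≡ {i} e b x {w} eq
    rewrite lookup∘tabulate (λ w → if does (block w Fin.≟ i) then byKind e b w else lookup x w) w
          | dec-true (block w Fin.≟ i) eq = refl

  lookup-freeze-≢ : ∀ {i} e b x {w} → block w ≢ i → lookup (freeze i e b x) w ≡ lookup x w
  lookup-freeze-≢ {i} e b x {w} neq
    rewrite lookup∘tabulate (λ w → if does (block w Fin.≟ i) then byKind e b w else lookup x w) w
          | dec-false (block w Fin.≟ i) neq = refl

  freeze-affine : ∀ i e b → AffineMap (freeze i e b)
  freeze-affine i e b = affineMap⁺ coord
    where
    coord : ∀ w → Affine (λ x → lookup (freeze i e b x) w)
    coord w x y z with block w Fin.≟ i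
    ... | yes eq rewrite lookup-freeze-≡ e b (x ⊕ y ⊕ z) eq | lookup-freeze-≡ e b x eq
                       | lookup-freeze-≡ e b y eq | lookup-freeze-≡ e b z eq
                 = affine-const (byKind e b w) x y z
    ... | no neq rewrite lookup-freeze-≢ e b (x ⊕ y ⊕ z) neq | lookup-freeze-≢ e b x neq
                       | lookup-freeze-≢ e b y neq | lookup-freeze-≢ e b z neq
                 = lookup-⊕³ x y z w

  module _ (v : Var) (e : Bool) (avoids : Y (block v) (constBits ℓ e) ≢ v) (b d : Bool)
           (x : Vec Bool (N * ℓ + N * 2 ^ ℓ)) where
    private
      i = block v
      y = add v d (freeze i e b x)

    -- If v is a pointer bit then it is no data bit; if v is a data bit then the
    -- pointer bits keep the value e, and the pointer avoids v.
    pointed≢v : Y i (pointer y i) ≢ v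
    pointed≢v eq = avoids (trans (cong (Y i) (sym pointer≡)) eq)
      where
      pointer≡ : pointer y i ≡ constBits ℓ e
      pointer≡ = fromBits-cong {ℓ} λ j → trans
        (lookup∘updateAt′ (X i j) v (λ x≡v → X≢Y (trans x≡v (sym eq))) (freeze i e b x))
        (trans (lookup-freeze-≡ e b x (block-X i j)) (byKind-X e b i j))

    lookup-outside : ∀ {w} → block w ≢ i → lookup y w ≡ lookup x w
    lookup-outside {w} w∉i = trans
      (lookup∘updateAt′ w v (w∉i ∘ cong block) (freeze i e b x))
      (lookup-freeze-≢ e b x w∉i)

    -- Every data bit of block `i` other than `v` holds `b`, and the pointer never selects `v`.
    -- Other blocks are untouched.
    IND-freeze : IND y ≡ IND x [ i ]≔ b
    IND-freeze = lookup-ext coord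
      where
      open ≡-Reasoning
      coord : ∀ k → lookup (IND y) k ≡ lookup (IND x [ i ]≔ b) k
      coord k with k Fin.≟ i
      ... | yes refl = begin
        lookup (IND y) i                                  ≡⟨ lookup∘tabulate _ i ⟩
        lookup y (Y i (pointer y i))                   ≡⟨ lookup∘updateAt′ _ v pointed≢v (freeze i e b x) ⟩
        lookup (freeze i e b x) (Y i (pointer y i))    ≡⟨ lookup-freeze-≡ e b x (block-Y i (pointer y i)) ⟩
        byKind e b (Y i (pointer y i))                 ≡⟨ byKind-Y e b i (pointer y i) ⟩
        b                                                 ≡⟨ lookup∘update i (IND x) b ⟨
        lookup (IND x [ i ]≔ b) i                         ∎
      ... | no k≢i = begin
        lookup (IND y) k                                  ≡⟨ lookup∘tabulate _ k ⟩
        lookup y (Y k (pointer y k))                   ≡⟨ lookup-outside (λ eq → k≢i (trans (sym (block-Y k _)) eq)) ⟩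
        lookup x (Y k (pointer y k))                   ≡⟨ cong (λ p → lookup x (Y k p)) pointer≡ ⟩
        lookup x (Y k (pointer x k))                   ≡⟨ lookup∘tabulate _ k ⟨
        lookup (IND x) k                                  ≡⟨ lookup∘update′ k≢i (IND x) b ⟨
        lookup (IND x [ i ]≔ b) k                         ∎
        where
        pointer≡ : pointer y k ≡ pointer x k
        pointer≡ = fromBits-cong {ℓ} λ j → lookup-outside (λ eq → k≢i (trans (sym (block-X k j)) eq))

IND-stifled : ∀ N ℓ → Stifled (Indexing.IND N (suc ℓ))
IND-stifled N ℓ v =
  let e , avoids = avoid in block v , λ b → freeze (block v) e b , freeze-affine (block v) e b , IND-freeze v e avoids b
  where
  open Indexing N (suc ℓ)

  -- The all-zeros and all-ones pointers select different data bits, so at least one of them misses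
  -- `v`.
  avoid : ∃ λ e → Y (block v) (constBits (suc ℓ) e) ≢ v
  avoid with Y (block v) (constBits (suc ℓ) false) Fin.≟ v
  ... | no  ≢v = false , ≢v
  ... | yes ≡v = true , λ ≡v′ → case constBits-injective {ℓ} {false} {true} (Y-injective (block v) (trans ≡v (sym ≡v′))) of λ ()

theorem18 : ∃[ m₀ ] (∀ m ℓ → m ≡ 2 ^ ℓ → m ≥ m₀ → ∀ N (f : BoolFun N) →
    Cᵈᵗ⊕ (f ∘IND^ ℓ) ≥ Cᵈᵗ f
    × sizeᵈᵗ⊕ (f ∘IND^ ℓ) ≥ 2 ^ Cᵈᵗ f
    × 2 ^ Cᵈᵗ f ≥ sizeᵈᵗ f)
-- The bound 2 excludes `ℓ = 0`, where a block is a single data bit: left free, it determines the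
-- output, so the gadget is not stifled.
theorem18 = 2 , λ
  { _ zero    refl (s≤s ())
  ; _ (suc ℓ) refl _ N f → height-bound N ℓ f , size-bound N ℓ f , sizeᵈᵗ≤2^Cᵈᵗ f }
  where
  lift : ∀ N ℓ (f : BoolFun N) T → Computes parityQuery (f ∘IND^ suc ℓ) T → 2 ^ Cᵈᵗ f ≤ leaves T
  lift N ℓ = 2^Cᵈᵗ≤leaves⊕ (Indexing.IND-surjective N (suc ℓ)) (IND-stifled N ℓ)

  -- For a parity tree `T` of least height, `2 ^ Cᵈᵗ f ≤ leaves T ≤ 2 ^ height T`; strict
  -- monotonicity of powers of 2 compares the exponents.
  height-bound : ∀ N ℓ (f : BoolFun N) → Cᵈᵗ f ≤ Cᵈᵗ⊕ (f ∘IND^ suc ℓ)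
  height-bound N ℓ f with attained (minHeight⊕ (f ∘IND^ suc ℓ))
  ... | T , T-computes , eq = subst (Cᵈᵗ f ≤_) eq
    (ℕ.≮⇒≥ λ height< → ℕ.<⇒≱ (ℕ.^-monoʳ-< 2 (s≤s (s≤s z≤n)) height<)
      (ℕ.≤-trans (lift N ℓ f T T-computes) (leaves≤2^height T)))

  size-bound : ∀ N ℓ (f : BoolFun N) → 2 ^ Cᵈᵗ f ≤ sizeᵈᵗ⊕ (f ∘IND^ suc ℓ)
  size-bound N ℓ f with attained (minLeaves⊕ (f ∘IND^ suc ℓ))
  ... | T , T-computes , eq = subst (2 ^ Cᵈᵗ f ≤_) eq (lift N ℓ f T T-computes)

  -- A tree of least height is a competitor for least size.
  sizeᵈᵗ≤2^Cᵈᵗ : ∀ {N} (f : BoolFun N) → sizeᵈᵗ f ≤ 2 ^ Cᵈᵗ f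
  sizeᵈᵗ≤2^Cᵈᵗ f with attained (minHeight f)
  ... | t , t-computes , eq = subst (λ k → sizeᵈᵗ f ≤ 2 ^ k) eq
    (ℕ.≤-trans (least (minLeaves f) t t-computes) (leaves≤2^height t))
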